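{- Let $\overrightarrow{W}$ be a Morse sequence on a simplicial complex $K$. Then for every integer $p\ge0$, the complex $W^-_{p+1}$ collapses onto $W^+_p$.
   Context: A simplicial complex $K$ is a finite collection of non-empty finite sets closed under taking non-empty subsets; $\dim\sigma=|\sigma|-1$. A pair $(\sigma,\tau)$ with $\sigma\subsetneq\tau$ is a free pair for $K$ if $\tau$ is the only simplex other than $\sigma$ containing $\sigma$; then $K\setminus\{\sigma,\tau\}$ is an elementary collapse of $K$ and $K$ an elementary expansion of $K\setminus\{\sigma,\tau\}$. $K$ collapses onto $L$ if there is a sequence $\langle K=L_0,\dots,L_m=L\rangle$, $m\ge0$, with each $L_j$ an elementary collapse of $L_{j-1}$. If $\nu$ is a facet (maximal simplex) of $K$, $K$ is an elementary filling of $K\setminus\{\nu\}$. A Morse sequence on $K$ is a sequence $\langle\emptyset=K_0,\dots,K_k=K\rangle$ with each $K_i$ an elementary expansion or filling of $K_{i-1}$; simplices added by fillings are critical; for an expansion $K_i=K_{i-1}\cup\{\sigma,\tau\}$, $\sigma\subset\tau$, $\sigma$ is lower regular and $\tau$ upper regular. Writing $\widehat W,\underline W,\overline W$ for the sets of critical, lower regular and upper regular simplices, the lower and upper $p$-skeletons are $W^-_p=\{\nu\in\overline W:\dim\nu\le p\}\cup\{\nu\in\widehat W\cup\underline W:\dim\nu\le p-1\}$ and $W^+_p=\{\nu\in\widehat W\cup\overline W:\dim\nu\le p\}\cup\{\nu\in\underline W:\dim\nu\le p-1\}$ (these are simplicial complexes). -}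

module Defs where

open import Data.Bool.Properties using () renaming (_≟_ to _≟ᵇ_)
open import Data.Empty using (⊥-elim)
open import Data.Fin using (Fin; zero; suc; inject₁; fromℕ)
open import Data.Fin.Induction using (<-weakInduction; >-weakInduction)
open import Data.Fin.Properties using (any?)
open import Data.Fin.Subset using (Subset; _⊆_; _⊂_; Nonempty; ∣_∣)
open import Data.Fin.Subset.Properties using (_∈?_; _⊆?_; _⊂?_; ⊆-antisym; anySubset?; p⊂q⇒∣p∣<∣q∣)
open import Data.Integer using (ℤ; +_; 1ℤ; _-_; _≤_; +<+; -_)
open import Data.Integer.Properties using (_≤?_; <-≤-trans; ≤-refl; ≤-trans; i<j⇒i≤pred[j]; i≤j⇒pred[i]≤j; +-comm; +-monoˡ-<)
open import Data.Nat using (ℕ; suc)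
open import Data.Product using (∃; ∃₂; _×_; _,_; proj₁; proj₂)
open import Data.Sum using (_⊎_; inj₁; inj₂)
open import Data.Vec.Properties using (≡-dec)
open import Level using (0ℓ)
open import Relation.Binary using (DecidableEquality)
open import Relation.Binary.PropositionalEquality using (_≡_; _≢_; refl; subst)
open import Relation.Nullary using (Dec; yes; no)
open import Relation.Nullary.Decidable using (map′; ¬?; _×-dec_; _⊎-dec_; _→-dec_; decidable-stable)
open import Relation.Unary using (Pred; Decidable; _≐_; _∪_; _∩_; _∖_; ∅; ｛_｝)
open import Relation.Unary.Properties using (_∪?_; _∩?_)

private
  variable
    n : ℕ

-- A finite collection of finite sets involves only finitely many vertices,
-- which are taken to be the elements of Fin n. Finiteness of the collection
-- is decidability of membership among the subsets of Fin n. The collection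
-- may be empty.
record SimplicialComplex (n : ℕ) : Set₁ where
  field
    Simplex    : Pred (Subset n) 0ℓ
    simplex?   : Decidable Simplex
    nonempty   : ∀ {σ} → Simplex σ → Nonempty σ
    downClosed : ∀ {σ τ} → Simplex τ → σ ⊆ τ → Nonempty σ → Simplex σ

open SimplicialComplex public

infix 4 _≈_
_≈_ : SimplicialComplex n → SimplicialComplex n → Set
K ≈ L = Simplex K ≐ Simplex L

dim : Subset n → ℤ
dim σ = + ∣ σ ∣ - 1ℤ

FreePair : SimplicialComplex n → Subset n → Subset n → Set
FreePair K σ τ =
  Simplex K σ × Simplex K τ × σ ⊂ τ ×
  (∀ ν → Simplex K ν → σ ⊆ ν → ν ≢ σ → ν ≡ τ)

Facet : SimplicialComplex n → Subset n → Set
Facet K ν = Simplex K ν × (∀ μ → Simplex K μ → ν ⊆ μ → μ ≡ ν)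

CollapseBy : (σ τ : Subset n) (K L : SimplicialComplex n) → Set
CollapseBy σ τ K L =
  FreePair K σ τ × (Simplex L ≐ Simplex K ∖ (｛ σ ｝ ∪ ｛ τ ｝))

ElementaryCollapse : (K L : SimplicialComplex n) → Set
ElementaryCollapse K L = ∃₂ λ σ τ → CollapseBy σ τ K L

-- Smaller complex first, unlike CollapseBy.
ExpansionBy : (σ τ : Subset n) (L K : SimplicialComplex n) → Set
ExpansionBy σ τ L K = CollapseBy σ τ K L

ElementaryExpansion : (L K : SimplicialComplex n) → Set
ElementaryExpansion L K = ∃₂ λ σ τ → ExpansionBy σ τ L K

FillingBy : (ν : Subset n) (L K : SimplicialComplex n) → Set
FillingBy ν L K = Facet K ν × (Simplex L ≐ Simplex K ∖ ｛ ν ｝)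

ElementaryFilling : (L K : SimplicialComplex n) → Set
ElementaryFilling L K = ∃ λ ν → FillingBy ν L K

record _CollapsesOnto_ (K L : SimplicialComplex n) : Set₁ where
  field
    steps   : ℕ
    complex : Fin (suc steps) → SimplicialComplex n
    first   : complex zero ≈ K
    last    : complex (fromℕ steps) ≈ L
    step    : ∀ j → ElementaryCollapse (complex (inject₁ j)) (complex (suc j))

record MorseSequence (K : SimplicialComplex n) : Set₁ where
  field
    steps   : ℕ
    complex : Fin (suc steps) → SimplicialComplex n
    first   : Simplex (complex zero) ≐ ∅
    last    : complex (fromℕ steps) ≈ K
    step    : ∀ i → ElementaryExpansion (complex (inject₁ i)) (complex (suc i))
                  ⊎ ElementaryFilling   (complex (inject₁ i)) (complex (suc i))

_≟ˢ_ : DecidableEquality (Subset n)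
_≟ˢ_ = ≡-dec _≟ᵇ_

allSubset? : {P : Pred (Subset n) 0ℓ} → Decidable P → Dec (∀ σ → P σ)
allSubset? P? = map′
  (λ ¬∃ σ → decidable-stable (P? σ) λ ¬p → ¬∃ (σ , ¬p))
  (λ ∀p (σ , ¬p) → ¬p (∀p σ))
  (¬? (anySubset? λ σ → ¬? (P? σ)))

≐? : {P Q : Pred (Subset n) 0ℓ} → Decidable P → Decidable Q → Dec (P ≐ Q)
≐? P? Q? = map′
  (λ (f , g) → (λ {x} → f x) , (λ {x} → g x))
  (λ (f , g) → (λ x → f {x}) , (λ x → g {x}))
  (allSubset? (λ x → P? x →-dec Q? x) ×-dec allSubset? (λ x → Q? x →-dec P? x))

collapseBy? : (σ τ : Subset n) (K L : SimplicialComplex n) → Dec (CollapseBy σ τ K L)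
collapseBy? σ τ K L =
  (simplex? K σ ×-dec simplex? K τ ×-dec σ ⊂? τ ×-dec
    allSubset? λ ν → simplex? K ν →-dec (σ ⊆? ν →-dec (¬? (ν ≟ˢ σ) →-dec (ν ≟ˢ τ))))
  ×-dec ≐? (simplex? L)
    (λ ν → simplex? K ν ×-dec ¬? ((σ ≟ˢ ν) ⊎-dec (τ ≟ˢ ν)))

fillingBy? : (ν : Subset n) (L K : SimplicialComplex n) → Dec (FillingBy ν L K)
fillingBy? ν L K =
  (simplex? K ν ×-dec allSubset? λ μ → simplex? K μ →-dec (ν ⊆? μ →-dec (μ ≟ˢ ν)))
  ×-dec ≐? (simplex? L) (λ μ → simplex? K μ ×-dec ¬? (ν ≟ˢ μ))

⊆∧≢⇒⊂ : {μ ν : Subset n} → μ ⊆ ν → μ ≢ ν → μ ⊂ ν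
⊆∧≢⇒⊂ {μ = μ} {ν} μ⊆ν μ≢ν = decidable-stable (μ ⊂? ν) λ μ⊄ν →
  μ≢ν (⊆-antisym μ⊆ν λ {x} x∈ν →
    decidable-stable (x ∈? μ) λ x∉μ → μ⊄ν (μ⊆ν , x , x∈ν , x∉μ))

dim-⊂ : {μ ν : Subset n} {p : ℤ} → μ ⊂ ν → dim ν ≤ p → dim μ ≤ p - 1ℤ
dim-⊂ {μ = μ} {p = p} μ⊂ν ν≤p = subst (dim μ ≤_) (+-comm (- 1ℤ) p)
  (i<j⇒i≤pred[j] (<-≤-trans (+-monoˡ-< (- 1ℤ) (+<+ (p⊂q⇒∣p∣<∣q∣ μ⊂ν))) ν≤p))

p-1≤p : ∀ p → p - 1ℤ ≤ p
p-1≤p p = subst (_≤ p) (+-comm (- 1ℤ) p) (i≤j⇒pred[i]≤j ≤-refl)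

module _ {K : SimplicialComplex n} (W : MorseSequence K) where
  open MorseSequence W

  Critical : Pred (Subset n) 0ℓ
  Critical ν = ∃ λ i → FillingBy ν (complex (inject₁ i)) (complex (suc i))

  LowerRegular : Pred (Subset n) 0ℓ
  LowerRegular σ = ∃₂ λ i τ → ExpansionBy σ τ (complex (inject₁ i)) (complex (suc i))

  UpperRegular : Pred (Subset n) 0ℓ
  UpperRegular τ = ∃₂ λ i σ → ExpansionBy σ τ (complex (inject₁ i)) (complex (suc i))

  LowerSkeletonSimplex : ℤ → Pred (Subset n) 0ℓ
  LowerSkeletonSimplex p =
    (UpperRegular ∩ λ ν → dim ν ≤ p) ∪ ((Critical ∪ LowerRegular) ∩ λ ν → dim ν ≤ p - 1ℤ)

  UpperSkeletonSimplex : ℤ → Pred (Subset n) 0ℓ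
  UpperSkeletonSimplex p =
    ((Critical ∪ UpperRegular) ∩ λ ν → dim ν ≤ p) ∪ (LowerRegular ∩ λ ν → dim ν ≤ p - 1ℤ)

  critical? : Decidable Critical
  critical? ν = any? λ i → fillingBy? ν (complex (inject₁ i)) (complex (suc i))

  lowerRegular? : Decidable LowerRegular
  lowerRegular? σ = any? λ i → anySubset? λ τ →
    collapseBy? σ τ (complex (suc i)) (complex (inject₁ i))

  upperRegular? : Decidable UpperRegular
  upperRegular? τ = any? λ i → anySubset? λ σ →
    collapseBy? σ τ (complex (suc i)) (complex (inject₁ i))

  dim≤? : (p : ℤ) → Decidable {A = Subset n} (λ ν → dim ν ≤ p)
  dim≤? p ν = dim ν ≤? p

  step-mono : ∀ i {ν} → Simplex (complex (inject₁ i)) ν → Simplex (complex (suc i)) ν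
  step-mono i s with step i
  ... | inj₁ (_ , _ , _ , L⊆ , _) = proj₁ (L⊆ s)
  ... | inj₂ (_ , _ , L⊆ , _)     = proj₁ (L⊆ s)

  complex⇒K : ∀ i {ν} → Simplex (complex i) ν → Simplex K ν
  complex⇒K = >-weakInduction (λ i → ∀ {ν} → Simplex (complex i) ν → Simplex K ν)
    (proj₁ last) (λ i ih s → ih (step-mono i s))

  critical⇒K : ∀ {ν} → Critical ν → Simplex K ν
  critical⇒K (i , (s , _) , _) = complex⇒K (suc i) s

  lower⇒K : ∀ {ν} → LowerRegular ν → Simplex K ν
  lower⇒K (i , _ , (s , _) , _) = complex⇒K (suc i) s

  upper⇒K : ∀ {ν} → UpperRegular ν → Simplex K ν
  upper⇒K (i , _ , (_ , t , _) , _) = complex⇒K (suc i) t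

  Classified : Pred (Subset n) 0ℓ
  Classified = Critical ∪ LowerRegular ∪ UpperRegular

  classify-step : ∀ i → (∀ {ν} → Simplex (complex (inject₁ i)) ν → Classified ν) →
                  ∀ {ν} → Simplex (complex (suc i)) ν → Classified ν
  classify-step i ih {ν} s with step i
  ... | inj₂ (μ , f , eq) with μ ≟ˢ ν
  ...   | yes refl = inj₁ (i , f , eq)
  ...   | no μ≢ν   = ih (proj₂ eq (s , μ≢ν))
  classify-step i ih {ν} s | inj₁ (σ , τ , f , eq) with σ ≟ˢ ν | τ ≟ˢ ν
  ...   | yes refl | _        = inj₂ (inj₁ (i , τ , f , eq))
  ...   | no _     | yes refl = inj₂ (inj₂ (i , σ , f , eq))
  ...   | no σ≢ν   | no τ≢ν   =
    ih (proj₂ eq (s , λ { (inj₁ e) → σ≢ν e ; (inj₂ e) → τ≢ν e }))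

  classify : ∀ {ν} → Simplex K ν → Classified ν
  classify s = <-weakInduction (λ i → ∀ {ν} → Simplex (complex i) ν → Classified ν)
    (λ s₀ → ⊥-elim (proj₁ first s₀)) classify-step (fromℕ steps) (proj₂ last s)

  lowerSkeleton⇒K : ∀ p {ν} → LowerSkeletonSimplex p ν → Simplex K ν
  lowerSkeleton⇒K p (inj₁ (u , _))      = upper⇒K u
  lowerSkeleton⇒K p (inj₂ (inj₁ c , _)) = critical⇒K c
  lowerSkeleton⇒K p (inj₂ (inj₂ l , _)) = lower⇒K l

  upperSkeleton⇒K : ∀ p {ν} → UpperSkeletonSimplex p ν → Simplex K ν
  upperSkeleton⇒K p (inj₁ (inj₁ c , _)) = critical⇒K c
  upperSkeleton⇒K p (inj₁ (inj₂ u , _)) = upper⇒K u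
  upperSkeleton⇒K p (inj₂ (l , _))      = lower⇒K l

  lowerSkeleton-dim : ∀ p {ν} → LowerSkeletonSimplex p ν → dim ν ≤ p
  lowerSkeleton-dim p (inj₁ (_ , d)) = d
  lowerSkeleton-dim p (inj₂ (_ , d)) = ≤-trans d (p-1≤p p)

  upperSkeleton-dim : ∀ p {ν} → UpperSkeletonSimplex p ν → dim ν ≤ p
  upperSkeleton-dim p (inj₁ (_ , d)) = d
  upperSkeleton-dim p (inj₂ (_ , d)) = ≤-trans d (p-1≤p p)

  K⇒lowerSkeleton : ∀ p {ν} → Simplex K ν → dim ν ≤ p - 1ℤ → LowerSkeletonSimplex p ν
  K⇒lowerSkeleton p s d with classify s
  ... | inj₁ c        = inj₂ (inj₁ c , d)
  ... | inj₂ (inj₁ l) = inj₂ (inj₂ l , d)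
  ... | inj₂ (inj₂ u) = inj₁ (u , ≤-trans d (p-1≤p p))

  K⇒upperSkeleton : ∀ p {ν} → Simplex K ν → dim ν ≤ p - 1ℤ → UpperSkeletonSimplex p ν
  K⇒upperSkeleton p s d with classify s
  ... | inj₁ c        = inj₁ (inj₁ c , ≤-trans d (p-1≤p p))
  ... | inj₂ (inj₁ l) = inj₂ (l , d)
  ... | inj₂ (inj₂ u) = inj₁ (inj₂ u , ≤-trans d (p-1≤p p))

  lowerSkeleton-down : ∀ p {σ τ} → LowerSkeletonSimplex p τ → σ ⊆ τ → Nonempty σ →
                       LowerSkeletonSimplex p σ
  lowerSkeleton-down p {σ} {τ} t σ⊆τ ne with σ ≟ˢ τ
  ... | yes refl = t
  ... | no σ≢τ   = K⇒lowerSkeleton p (downClosed K (lowerSkeleton⇒K p t) σ⊆τ ne)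
                     (dim-⊂ (⊆∧≢⇒⊂ σ⊆τ σ≢τ) (lowerSkeleton-dim p t))

  upperSkeleton-down : ∀ p {σ τ} → UpperSkeletonSimplex p τ → σ ⊆ τ → Nonempty σ →
                       UpperSkeletonSimplex p σ
  upperSkeleton-down p {σ} {τ} t σ⊆τ ne with σ ≟ˢ τ
  ... | yes refl = t
  ... | no σ≢τ   = K⇒upperSkeleton p (downClosed K (upperSkeleton⇒K p t) σ⊆τ ne)
                     (dim-⊂ (⊆∧≢⇒⊂ σ⊆τ σ≢τ) (upperSkeleton-dim p t))

  lowerSkeleton : ℤ → SimplicialComplex n
  lowerSkeleton p = record
    { Simplex    = LowerSkeletonSimplex p
    ; simplex?   = (upperRegular? ∩? dim≤? p) ∪? ((critical? ∪? lowerRegular?) ∩? dim≤? (p - 1ℤ))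
    ; nonempty   = λ s → nonempty K (lowerSkeleton⇒K p s)
    ; downClosed = lowerSkeleton-down p
    }

  upperSkeleton : ℤ → SimplicialComplex n
  upperSkeleton p = record
    { Simplex    = UpperSkeletonSimplex p
    ; simplex?   = ((critical? ∪? upperRegular?) ∩? dim≤? p) ∪? (lowerRegular? ∩? dim≤? (p - 1ℤ))
    ; nonempty   = λ s → nonempty K (upperSkeleton⇒K p s)
    ; downClosed = upperSkeleton-down p
    }

{-# OPTIONS --safe #-}
module Submission where

-- W⁻_{p+1} exceeds W⁺_p exactly by the regular pairs (σ , τ) with dim σ = p,
-- since the two members of a free pair differ by one vertex. These pairs are
-- removed in the reverse of their order of appearance in W: among the
-- complexes W⁺_p ∪ (W⁻_{p+1} ∩ K_i), consecutive ones are either equal or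
-- differ by such a pair, and the pair is then free, because a coface of σ lies
-- in K_{i+1}, where (σ , τ) is free, or in W⁺_p, where its dimension would be
-- at most p.

open import Data.Bool using (true; false)
open import Data.Empty using (⊥-elim)
open import Data.Fin using (Fin; zero; suc; inject₁; fromℕ; toℕ)
open import Data.Fin.Induction using (<-weakInduction; <-weakInduction-startingFrom)
open import Data.Fin.Properties using (toℕ-inject₁; <-cmp)
open import Data.Fin.Subset using (Subset; _∈_; _⊆_; _⊂_; ∣_∣; ⁅_⁆) renaming (_∪_ to _∪ˢ_)
open import Data.Fin.Subset.Properties using (⊆-trans; ∣⁅x⁆∣≡1; x∈⁅x⁆; x∈⁅y⁆⇒x≡y; p⊆p∪q; q⊆p∪q; x∈p∪q⁻)
open import Data.Integer using (ℤ; +_; 0ℤ; 1ℤ; -_; _+_; _-_; _≤_; +≤+)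
open import Data.Integer.Properties using (_≤?_; +-assoc; +-comm; +-identityʳ; +-monoˡ-≤; module ≤-Reasoning)
open import Data.Nat using (ℕ; suc; z≤n; s≤s)
open import Data.Product using (_×_; _,_; proj₁; proj₂)
open import Data.Sum using (_⊎_; inj₁; inj₂; [_,_]′; map₂)
open import Data.Vec using ([]; _∷_)
open import Function using (id; _∘_)
open import Relation.Binary using (tri<; tri≈; tri>)
open import Relation.Binary.PropositionalEquality using (_≡_; _≢_; refl; sym; trans; cong; subst)
open import Relation.Nullary using (¬_; yes; no)
open import Relation.Unary using (_∪_; _∩_)
open import Relation.Unary.Properties using (_∪?_; _∩?_; ≐-sym; ≐-trans)
open import Defs
import Data.Fin as Fin
import Data.Nat as ℕ
import Data.Nat.Properties as ℕₚ

private
  variable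
    n : ℕ

-- Dimensions in a free pair.

∣p∪q∣≤∣p∣+∣q∣ : (p q : Subset n) → ∣ p ∪ˢ q ∣ ℕ.≤ ∣ p ∣ ℕ.+ ∣ q ∣
∣p∪q∣≤∣p∣+∣q∣ []          []          = z≤n
∣p∪q∣≤∣p∣+∣q∣ (false ∷ p) (false ∷ q) = ∣p∪q∣≤∣p∣+∣q∣ p q
∣p∪q∣≤∣p∣+∣q∣ (false ∷ p) (true  ∷ q) =
  ℕₚ.≤-trans (s≤s (∣p∪q∣≤∣p∣+∣q∣ p q)) (ℕₚ.≤-reflexive (sym (ℕₚ.+-suc ∣ p ∣ ∣ q ∣)))
∣p∪q∣≤∣p∣+∣q∣ (true  ∷ p) (false ∷ q) = s≤s (∣p∪q∣≤∣p∣+∣q∣ p q)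
∣p∪q∣≤∣p∣+∣q∣ (true  ∷ p) (true  ∷ q) =
  s≤s (ℕₚ.≤-trans (∣p∪q∣≤∣p∣+∣q∣ p q) (ℕₚ.+-monoʳ-≤ ∣ p ∣ (ℕₚ.n≤1+n ∣ q ∣)))

⊂-irrefl : {σ : Subset n} → ¬ σ ⊂ σ
⊂-irrefl (_ , _ , x∈σ , x∉σ) = x∉σ x∈σ

i+1-1≡i : ∀ i → i + 1ℤ - 1ℤ ≡ i
i+1-1≡i i = trans (+-assoc i 1ℤ (- 1ℤ)) (+-identityʳ i)

i-1+1≡i : ∀ i → i - 1ℤ + 1ℤ ≡ i
i-1+1≡i i = trans (+-assoc i (- 1ℤ) 1ℤ) (+-identityʳ i)

-- Adding to `σ` one vertex of `τ` outside `σ` gives a face of `τ` that properly contains `σ`;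
-- freeness forces it to be `τ` itself.
freePair-∣∣ : (K : SimplicialComplex n) {σ τ : Subset n} → FreePair K σ τ → ∣ τ ∣ ℕ.≤ suc ∣ σ ∣
freePair-∣∣ K {σ} {τ} (s , t , (σ⊆τ , x , x∈τ , x∉σ) , unique) = begin
  ∣ τ ∣                ≡⟨ cong ∣_∣ (sym σ∪x≡τ) ⟩
  ∣ σ ∪ˢ ⁅ x ⁆ ∣       ≤⟨ ∣p∪q∣≤∣p∣+∣q∣ σ ⁅ x ⁆ ⟩
  ∣ σ ∣ ℕ.+ ∣ ⁅ x ⁆ ∣  ≡⟨ cong (∣ σ ∣ ℕ.+_) (∣⁅x⁆∣≡1 x) ⟩
  ∣ σ ∣ ℕ.+ 1          ≡⟨ ℕₚ.+-comm ∣ σ ∣ 1 ⟩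
  suc ∣ σ ∣            ∎
  where
  open ℕₚ.≤-Reasoning

  x∈σ∪x = q⊆p∪q σ ⁅ x ⁆ (x∈⁅x⁆ x)

  σ∪x⊆τ : σ ∪ˢ ⁅ x ⁆ ⊆ τ
  σ∪x⊆τ y∈ with x∈p∪q⁻ σ ⁅ x ⁆ y∈
  ... | inj₁ y∈σ = σ⊆τ y∈σ
  ... | inj₂ y∈x with refl ← x∈⁅y⁆⇒x≡y x y∈x = x∈τ

  σ∪x≡τ : σ ∪ˢ ⁅ x ⁆ ≡ τ
  σ∪x≡τ = unique _ (downClosed K t σ∪x⊆τ (x , x∈σ∪x)) (p⊆p∪q ⁅ x ⁆)
    λ eq → x∉σ (subst (x ∈_) eq x∈σ∪x)

freePair-dim : (K : SimplicialComplex n) {σ τ : Subset n} {p : ℤ} →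
               FreePair K σ τ → dim σ ≤ p → dim τ ≤ p + 1ℤ
freePair-dim K {σ} {τ} {p} f σ≤p = begin
  -- `+ suc ∣ σ ∣` computes to `1ℤ + + ∣ σ ∣`.
  dim τ              ≤⟨ +-monoˡ-≤ (- 1ℤ) (+≤+ (freePair-∣∣ K f)) ⟩
  1ℤ + + ∣ σ ∣ - 1ℤ  ≡⟨ +-assoc 1ℤ (+ ∣ σ ∣) (- 1ℤ) ⟩
  1ℤ + dim σ         ≡⟨ +-comm 1ℤ (dim σ) ⟩
  dim σ + 1ℤ         ≤⟨ +-monoˡ-≤ 1ℤ σ≤p ⟩
  p + 1ℤ             ∎
  where open ≤-Reasoning

-- Unions and intersections of complexes.

infixr 6 _∪ᶜ_
_∪ᶜ_ : (K L : SimplicialComplex n) → SimplicialComplex n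
K ∪ᶜ L = record
  { Simplex    = Simplex K ∪ Simplex L
  ; simplex?   = simplex? K ∪? simplex? L
  ; nonempty   = [ nonempty K , nonempty L ]′
  ; downClosed = λ where
      (inj₁ k) σ⊆τ ne → inj₁ (downClosed K k σ⊆τ ne)
      (inj₂ l) σ⊆τ ne → inj₂ (downClosed L l σ⊆τ ne)
  }

infixr 7 _∩ᶜ_
_∩ᶜ_ : (K L : SimplicialComplex n) → SimplicialComplex n
K ∩ᶜ L = record
  { Simplex    = Simplex K ∩ Simplex L
  ; simplex?   = simplex? K ∩? simplex? L
  ; nonempty   = nonempty K ∘ proj₁
  ; downClosed = λ (k , l) σ⊆τ ne → downClosed K k σ⊆τ ne , downClosed L l σ⊆τ ne
  }

-- Building collapse sequences.

≈⇒collapsesOnto : {K L : SimplicialComplex n} → K ≈ L → K CollapsesOnto L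
≈⇒collapsesOnto {L = L} K≈L = record
  { steps   = 0
  ; complex = λ _ → L
  ; first   = ≐-sym K≈L
  ; last    = id , id
  ; step    = λ ()
  }

collapsesOnto-respˡ : {K L M : SimplicialComplex n} → K ≈ L → L CollapsesOnto M → K CollapsesOnto M
collapsesOnto-respˡ K≈L L↘M = record
  { steps   = steps
  ; complex = complex
  ; first   = ≐-trans first (≐-sym K≈L)
  ; last    = last
  ; step    = step
  }
  where open _CollapsesOnto_ L↘M

collapsesOnto-cons : {K L M : SimplicialComplex n} →
                     ElementaryCollapse K L → L CollapsesOnto M → K CollapsesOnto M
collapsesOnto-cons {n = n} {K} (σ , τ , free , L≐) L↘M = record
  { steps   = suc steps
  ; complex = complex′
  ; first   = id , id
  ; last    = last
  ; step    = step′
  }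
  where
  open _CollapsesOnto_ L↘M

  complex′ : Fin (suc (suc steps)) → SimplicialComplex n
  complex′ zero    = K
  complex′ (suc i) = complex i

  step′ : ∀ j → ElementaryCollapse (complex′ (inject₁ j)) (complex′ (suc j))
  -- The old sequence starts at a complex that only agrees with `L` up to `≈`, so the description of
  -- `L` as `K` without the pair is carried over along `first`.
  step′ zero    = σ , τ , free , ≐-trans first L≐
  step′ (suc j) = step j

-- Each simplex enters a Morse sequence once, in a single role.

module _ {K : SimplicialComplex n} (W : MorseSequence K) where
  open MorseSequence W

  complex-mono : ∀ {i j ν} → i Fin.≤ j → Simplex (complex i) ν → Simplex (complex j) ν
  complex-mono {ν = ν} i≤j s =
    <-weakInduction-startingFrom (λ j → Simplex (complex j) ν) s (λ j → step-mono W j) i≤j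

  Added : Fin steps → Subset n → Set
  Added i ν = Simplex (complex (suc i)) ν × ¬ Simplex (complex (inject₁ i)) ν

  -- The complexes only grow, so what enters at the earlier of two different steps is already
  -- present before the later one.
  added-once : ∀ {i j ν} → Added i ν → Added j ν → i ≡ j
  added-once {i} {j} (s , s∉) (t , t∉) with <-cmp i j
  ... | tri< i<j _ _ = ⊥-elim (t∉ (complex-mono (subst (suc (toℕ i) ℕ.≤_) (sym (toℕ-inject₁ j)) i<j) s))
  ... | tri≈ _ i≡j _ = i≡j
  ... | tri> _ _ j<i = ⊥-elim (s∉ (complex-mono (subst (suc (toℕ j) ℕ.≤_) (sym (toℕ-inject₁ i)) j<i) t))

  lower-added : ∀ {i σ τ} → ExpansionBy σ τ (complex (inject₁ i)) (complex (suc i)) → Added i σ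
  lower-added ((s , _) , L⊆ , _) = s , λ s′ → proj₂ (L⊆ s′) (inj₁ refl)

  upper-added : ∀ {i σ τ} → ExpansionBy σ τ (complex (inject₁ i)) (complex (suc i)) → Added i τ
  upper-added ((_ , t , _) , L⊆ , _) = t , λ t′ → proj₂ (L⊆ t′) (inj₂ refl)

  critical-added : ∀ {i ν} → FillingBy ν (complex (inject₁ i)) (complex (suc i)) → Added i ν
  critical-added ((s , _) , L⊆ , _) = s , λ s′ → proj₂ (L⊆ s′) refl

  filling-adds-only : ∀ {i μ} → FillingBy μ (complex (inject₁ i)) (complex (suc i)) →
                      ∀ {ν} → Added i ν → μ ≡ ν
  filling-adds-only {μ = μ} (_ , _ , ⊆L) {ν} (s , s∉) with μ ≟ˢ ν
  ... | yes μ≡ν = μ≡ν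
  ... | no μ≢ν  = ⊥-elim (s∉ (⊆L (s , μ≢ν)))

  expansion-adds-only : ∀ {i σ τ} → ExpansionBy σ τ (complex (inject₁ i)) (complex (suc i)) →
                        ∀ {ν} → Added i ν → σ ≡ ν ⊎ τ ≡ ν
  expansion-adds-only {σ = σ} {τ} (_ , _ , ⊆L) {ν} (s , s∉) with σ ≟ˢ ν | τ ≟ˢ ν
  ... | yes σ≡ν | _       = inj₁ σ≡ν
  ... | no _    | yes τ≡ν = inj₂ τ≡ν
  ... | no σ≢ν  | no τ≢ν  = ⊥-elim (s∉ (⊆L (s , [ σ≢ν , τ≢ν ]′)))

  -- Both roles would be taken at the same step, where `σ` would be a facet with the proper coface
  -- `τ`.
  lower∉critical : ∀ {σ} → LowerRegular W σ → ¬ Critical W σ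
  lower∉critical (i , τ , e@((_ , t , σ⊂τ , _) , _)) (j , f@((_ , maximal) , _))
    with refl ← added-once (lower-added e) (critical-added f)
    with refl ← maximal τ t (proj₁ σ⊂τ) = ⊂-irrefl σ⊂τ

  -- At the common step `ρ` would have both `σ` and `τ` as proper cofaces, so its freeness would
  -- identify them.
  lower∉upper : ∀ {σ} → LowerRegular W σ → ¬ UpperRegular W σ
  lower∉upper (i , τ , e@((_ , t , σ⊂τ , _) , _)) (j , ρ , e′@((_ , _ , ρ⊂σ , unique) , _))
    with refl ← added-once (lower-added e) (upper-added e′)
    with refl ← unique τ t (⊆-trans (proj₁ ρ⊂σ) (proj₁ σ⊂τ))
                  -- If `τ` were `ρ`, the vertex of `σ` missing from `ρ` would lie in it after all.
                  (λ { refl → proj₂ (proj₂ (proj₂ ρ⊂σ)) (proj₁ σ⊂τ (proj₁ (proj₂ (proj₂ ρ⊂σ)))) })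
    = ⊂-irrefl σ⊂τ

  -- A filling adds a single simplex, whereas an expansion adds `σ` along with `τ`.
  upper∉critical : ∀ {τ} → UpperRegular W τ → ¬ Critical W τ
  upper∉critical (i , σ , e@((_ , _ , σ⊂τ , _) , _)) (j , f)
    with refl ← added-once (upper-added e) (critical-added f)
    with refl ← filling-adds-only f (lower-added e) = ⊂-irrefl σ⊂τ

  -- Membership in a skeleton comes from some role with its own dimension bound; as the roles are
  -- disjoint, the known role decides which bound holds. The next two lemmas work alike.
  lower-upperSkeleton : ∀ {p σ} → LowerRegular W σ → UpperSkeletonSimplex W p σ → dim σ ≤ p - 1ℤ
  lower-upperSkeleton l (inj₁ (inj₁ c , _)) = ⊥-elim (lower∉critical l c)
  lower-upperSkeleton l (inj₁ (inj₂ u , _)) = ⊥-elim (lower∉upper l u)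
  lower-upperSkeleton l (inj₂ (_ , d))      = d

  lower-lowerSkeleton : ∀ {p σ} → LowerRegular W σ → LowerSkeletonSimplex W p σ → dim σ ≤ p - 1ℤ
  lower-lowerSkeleton l (inj₁ (u , _)) = ⊥-elim (lower∉upper l u)
  lower-lowerSkeleton l (inj₂ (_ , d)) = d

  critical-lowerSkeleton : ∀ {p ν} → Critical W ν → LowerSkeletonSimplex W p ν → dim ν ≤ p - 1ℤ
  critical-lowerSkeleton c (inj₁ (u , _)) = ⊥-elim (upper∉critical u c)
  critical-lowerSkeleton c (inj₂ (_ , d)) = d

  -- The stages between the two skeletons.

  module _ (p : ℤ) where

    stage : Fin (suc steps) → SimplicialComplex n
    stage i = upperSkeleton W p ∪ᶜ lowerSkeleton W (p + 1ℤ) ∩ᶜ complex i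

    -- W⁻_{p+1} contains every simplex of `K` of dimension at most `p`, whatever its role.
    upper⊆lower : ∀ {ν} → UpperSkeletonSimplex W p ν → LowerSkeletonSimplex W (p + 1ℤ) ν
    upper⊆lower {ν} u = K⇒lowerSkeleton W (p + 1ℤ) (upperSkeleton⇒K W p u)
      (subst (dim ν ≤_) (sym (i+1-1≡i p)) (upperSkeleton-dim W p u))

    stage-first : stage zero ≈ upperSkeleton W p
    stage-first = [ id , (λ (_ , s) → ⊥-elim (proj₁ first s)) ]′ , inj₁

    stage-last : lowerSkeleton W (p + 1ℤ) ≈ stage (fromℕ steps)
    stage-last = (λ l → inj₂ (l , proj₂ last (lowerSkeleton⇒K W (p + 1ℤ) l)))
               , [ upper⊆lower , proj₁ ]′

    stage-mono : ∀ i {ν} → Simplex (stage (inject₁ i)) ν → Simplex (stage (suc i)) ν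
    stage-mono i = map₂ λ (l , s) → l , step-mono W i s

    -- Only simplices added at step `i` can tell the two stages apart, and those in W⁺_p belong to
    -- every stage.
    stage-unchanged : ∀ i →
      (∀ {ν} → Added i ν → LowerSkeletonSimplex W (p + 1ℤ) ν → UpperSkeletonSimplex W p ν) →
      stage (suc i) ≈ stage (inject₁ i)
    stage-unchanged i added⇒upper = shrink , stage-mono i
      where
      shrink : ∀ {ν} → Simplex (stage (suc i)) ν → Simplex (stage (inject₁ i)) ν
      shrink (inj₁ u) = inj₁ u
      shrink {ν} (inj₂ (l , s)) with simplex? (complex (inject₁ i)) ν
      ... | yes s′ = inj₂ (l , s′)
      ... | no s∉  = inj₁ (added⇒upper (s , s∉) l)

    -- Critical simplices obey the same bound in both skeletons: `p + 1ℤ - 1ℤ` in W⁻_{p+1} and `p`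
    -- in W⁺_p.
    stage-filling : ∀ i → ElementaryFilling (complex (inject₁ i)) (complex (suc i)) →
                    stage (suc i) ≈ stage (inject₁ i)
    stage-filling i (μ , f) = stage-unchanged i added⇒upper
      where
      added⇒upper : ∀ {ν} → Added i ν → LowerSkeletonSimplex W (p + 1ℤ) ν → UpperSkeletonSimplex W p ν
      added⇒upper a l with refl ← filling-adds-only f a =
        inj₁ (inj₁ (i , f) , subst (dim μ ≤_) (i+1-1≡i p) (critical-lowerSkeleton (i , f) l))

    -- Three cases: if `dim σ` is below `p`, the pair is already in W⁺_p; above `p`, neither member
    -- is in W⁻_{p+1}; at exactly `p`, expressed by two inequalities, the pair is collapsed.
    stage-expansion : ∀ i {σ τ} → ExpansionBy σ τ (complex (inject₁ i)) (complex (suc i)) →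
                      stage (suc i) ≈ stage (inject₁ i) ⊎ ElementaryCollapse (stage (suc i)) (stage (inject₁ i))
    stage-expansion i {σ} {τ} e@(f@(s , t , σ⊂τ , unique) , L≐) with dim σ ≤? p - 1ℤ | dim σ ≤? p
    ... | yes σ≤p-1 | _ = inj₁ (stage-unchanged i λ a _ → added⇒upper (expansion-adds-only e a))
      where
      added⇒upper : ∀ {ν} → σ ≡ ν ⊎ τ ≡ ν → UpperSkeletonSimplex W p ν
      added⇒upper (inj₁ refl) = inj₂ ((i , τ , e) , σ≤p-1)
      added⇒upper (inj₂ refl) = inj₁ (inj₂ (i , σ , e) ,
        subst (dim τ ≤_) (i-1+1≡i p) (freePair-dim (complex (suc i)) f σ≤p-1))
    ... | no _ | no σ≰p = inj₁ (stage-unchanged i λ a l → ⊥-elim (absent (expansion-adds-only e a) l))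
      where
      absent : ∀ {ν} → σ ≡ ν ⊎ τ ≡ ν → ¬ LowerSkeletonSimplex W (p + 1ℤ) ν
      absent (inj₁ refl) l = σ≰p (subst (dim σ ≤_) (i+1-1≡i p) (lower-lowerSkeleton (i , τ , e) l))
      -- In W⁻_{p+1}, `τ` has dimension at most `p + 1ℤ`, so its proper face `σ` would have
      -- dimension at most `p`.
      absent (inj₂ refl) l = σ≰p (subst (dim σ ≤_) (i+1-1≡i p)
        (dim-⊂ σ⊂τ (lowerSkeleton-dim W (p + 1ℤ) l)))
    ... | no σ≰p-1 | yes σ≤p = inj₂ (σ , τ , (σ∈ , τ∈ , σ⊂τ , free) , removed , restored)
      where
      σ∈ : Simplex (stage (suc i)) σ
      σ∈ = inj₂ (inj₂ (inj₂ (i , τ , e) , subst (dim σ ≤_) (sym (i+1-1≡i p)) σ≤p) , s)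

      τ∈ : Simplex (stage (suc i)) τ
      τ∈ = inj₂ (inj₁ ((i , σ , e) , freePair-dim (complex (suc i)) f σ≤p) , t)

      free : ∀ ν → Simplex (stage (suc i)) ν → σ ⊆ ν → ν ≢ σ → ν ≡ τ
      free ν (inj₁ u) σ⊆ν ν≢σ =
        ⊥-elim (σ≰p-1 (dim-⊂ (⊆∧≢⇒⊂ σ⊆ν (ν≢σ ∘ sym)) (upperSkeleton-dim W p u)))
      free ν (inj₂ (_ , v)) σ⊆ν ν≢σ = unique ν v σ⊆ν ν≢σ

      absent : ∀ {ν} → Simplex (stage (inject₁ i)) ν → ¬ (σ ≡ ν ⊎ τ ≡ ν)
      -- Either member lying in W⁺_p would bound `dim σ` by `p - 1ℤ`: `σ` through its role, `τ`
      -- through its dimension.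
      absent (inj₁ u) (inj₁ refl) = σ≰p-1 (lower-upperSkeleton (i , τ , e) u)
      absent (inj₁ u) (inj₂ refl) = σ≰p-1 (dim-⊂ σ⊂τ (upperSkeleton-dim W p u))
      absent (inj₂ (_ , v)) eq    = proj₂ (proj₁ L≐ v) eq

      removed : ∀ {ν} → Simplex (stage (inject₁ i)) ν →
                Simplex (stage (suc i)) ν × ¬ (σ ≡ ν ⊎ τ ≡ ν)
      removed v = stage-mono i v , absent v

      restored : ∀ {ν} → Simplex (stage (suc i)) ν × ¬ (σ ≡ ν ⊎ τ ≡ ν) →
                 Simplex (stage (inject₁ i)) ν
      restored (inj₁ u , _)        = inj₁ u
      restored (inj₂ (l , v) , ≢s) = inj₂ (l , proj₂ L≐ (v , ≢s))

    -- The induction follows the Morse sequence forwards and prepends each new collapse, so the pair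
    -- added last is removed first.
    stage-collapsesOnto : ∀ i → stage i CollapsesOnto upperSkeleton W p
    stage-collapsesOnto = <-weakInduction (λ i → stage i CollapsesOnto upperSkeleton W p)
      (≈⇒collapsesOnto stage-first) extend
      where
      extend : ∀ i → stage (inject₁ i) CollapsesOnto upperSkeleton W p →
               stage (suc i) CollapsesOnto upperSkeleton W p
      extend i ih with step i
      ... | inj₂ f = collapsesOnto-respˡ (stage-filling i f) ih
      ... | inj₁ (_ , _ , e) with stage-expansion i e
      ...   | inj₁ eq = collapsesOnto-respˡ eq ih
      ...   | inj₂ c  = collapsesOnto-cons c ih

theorem6 : (n : ℕ) (K : SimplicialComplex n) (W : MorseSequence K) →
    ∀ (p : ℤ) → 0ℤ ≤ p → lowerSkeleton W (p + 1ℤ) CollapsesOnto upperSkeleton W p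
theorem6 n K W p _ =
  collapsesOnto-respˡ (stage-last W p) (stage-collapsesOnto W p (fromℕ (MorseSequence.steps W)))
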